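{- For $A \in \mathbf{DLat}$ and any regular cardinal $\kappa$, (1) $A\in\kappa\mathbf{H}$ if and only if $\mathrm{p}\mathcal{H} A \subseteq \mathcal{BL}_\kappa A$; (2) $A\in\mathbf{pro}\kappa\mathbf{H}$ if and only if $\mathrm{p}\mathcal{H} A \subseteq \mathcal{BL}_\kappa A \cap \mathcal{DM} A$.
   Context: $\mathbf{DLat}$ is the class of bounded distributive lattices. For $A\in\mathbf{DLat}$: $\mathcal{DM} A$ is the Dedekind-MacNeille completion (normal ideals $N=N^{u\ell}$); a join $\bigvee S$ existing in $A$ is distributive if $a\wedge\bigvee S=\bigvee\{a\wedge s: s\in S\}$ for all $a\in A$; $\mathcal{BL} A$ (the Bruns-Lakser completion) is the frame of D-ideals of $A$ (downsets closed under distributive joins of their subsets); $A$ is identified with its principal downsets, so $A\subseteq\mathcal{DM} A\subseteq\mathcal{BL} A$. For a regular cardinal $\kappa$, a $\kappa$-frame is a lattice in which all joins of sets of cardinality $<\kappa$ exist and are distributive, and $\mathcal{BL}_\kappa A$ is the sub-$\kappa$-frame of $\mathcal{BL} A$ generated by $A$. A relative annihilator is $\langle a,b\rangle=\{x\in A: a\wedge x\le b\}$, and $\mathcal{R} A$ is the set of relative annihilators. The proHeyting extension $\mathrm{p}\mathcal{H} A$ is the bounded sublattice of $\mathcal{BL} A$ generated by $\mathcal{R} A$. $A\in\kappa\mathbf{H}$ means $\mathcal{R} A\subseteq\mathcal{BL}_\kappa A$; $A\in\mathbf{pro}\kappa\mathbf{H}$ means $\mathcal{R} A\subseteq\mathcal{BL}_\kappa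 A\cap\mathcal{DM} A$. $A$ is proHeyting if $\mathcal{R} A\subseteq\mathcal{DM} A$, equivalently $\mathcal{DM} A=\mathcal{BL} A$. -}

module Defs where

open import Algebra.Definitions using (_DistributesOverˡ_)
open import Data.Nat.Base using (ℕ)
open import Data.Product.Base using (Σ; ∃; ∃₂; _×_; _,_; proj₁; proj₂)
open import Data.Sum.Base using (inj₁; inj₂)
open import Function.Base using (_∘_)
open import Function.Bundles using (_↣_)
open import Level using (Level; suc)
open import Relation.Binary.Lattice
  using (BoundedLattice; IsDistributiveLattice)
open import Relation.Nullary using (¬_)
open import Relation.Unary using (Pred; _∈_; _⊆_; _≐_; _∩_; _∪_; ⋃)

private
  variable
    ℓ : Level

-- All sets, subsets and cardinals live in one universe `Set ℓ`.

record BoundedDistributiveLattice (ℓ : Level) : Set (suc ℓ) where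
  field
    boundedLattice : BoundedLattice ℓ ℓ ℓ

  open BoundedLattice boundedLattice public

  field
    ∧-distribˡ-∨ : _DistributesOverˡ_ _≈_ _∧_ _∨_

  isDistributiveLattice : IsDistributiveLattice _≈_ _≤_ _∨_ _∧_
  isDistributiveLattice = record
    { isLattice = isLattice ; ∧-distribˡ-∨ = ∧-distribˡ-∨ }

-- Strict comparison of cardinalities, |I| < |J|.
infix 4 _≺_
_≺_ : Set ℓ → Set ℓ → Set ℓ
I ≺ J = (I ↣ J) × ¬ (J ↣ I)

-- A cardinal is represented by any set of that cardinality.  Regularity: a sum
-- of fewer than κ sets, each of size less than κ, has size less than κ.
record RegularCardinal (ℓ : Level) : Set (suc ℓ) where
  field
    ∣_∣      : Set ℓ
    infinite : ℕ ↣ ∣_∣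
    regular  : (I : Set ℓ) (J : I → Set ℓ) →
               I ≺ ∣_∣ → (∀ i → J i ≺ ∣_∣) → Σ I J ≺ ∣_∣

module Completions {ℓ : Level} (A : BoundedDistributiveLattice ℓ) where
  open BoundedDistributiveLattice A
    renaming (trans to ≤-trans; refl to ≤-refl; reflexive to ≤-reflexive)
  open Eq using () renaming (refl to ≈-refl)

  Subset : Set (suc ℓ)
  Subset = Pred Carrier ℓ

  upper lower : Subset → Subset
  upper P u = ∀ x → x ∈ P → x ≤ u
  lower P l = ∀ x → x ∈ P → l ≤ x

  IsNormal : Subset → Set ℓ
  IsNormal N = N ≐ lower (upper N)

  IsJoin : Subset → Carrier → Set ℓ
  IsJoin S x = x ∈ upper S × x ∈ lower (upper S)

  _∧[_] : Carrier → Subset → Subset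
  a ∧[ S ] = λ y → ∃ λ s → s ∈ S × y ≈ a ∧ s

  IsDistributiveJoin : Subset → Carrier → Set ℓ
  IsDistributiveJoin S x = IsJoin S x × (∀ a → IsJoin (a ∧[ S ]) (a ∧ x))

  record DIdeal : Set (suc ℓ) where
    field
      ⟦_⟧        : Subset
      downClosed : ∀ {x y} → x ≤ y → y ∈ ⟦_⟧ → x ∈ ⟦_⟧
      joinClosed : ∀ (S : Subset) {x} → S ⊆ ⟦_⟧ → IsDistributiveJoin S x → x ∈ ⟦_⟧

  open DIdeal public

  ↓_ : Carrier → DIdeal
  ⟦ ↓ a ⟧ x = x ≤ a
  downClosed (↓ a) = ≤-trans
  joinClosed (↓ a) S S⊆ ((_ , least) , _) = least a (λ _ → S⊆)

  ann : Carrier → Carrier → DIdeal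
  ⟦ ann a b ⟧ x = a ∧ x ≤ b
  downClosed (ann a b) {x} {y} x≤y p =
    ≤-trans (∧-greatest (x∧y≤x a x) (≤-trans (x∧y≤y a x) x≤y)) p
  joinClosed (ann a b) S S⊆ (_ , dist) =
    proj₂ (dist a) b λ { _ (s , s∈S , y≈) → ≤-trans (≤-reflexive y≈) (S⊆ s∈S) }

  -- Every normal set is a D-ideal, so 𝓓𝓜 A can be taken as a subset of 𝓑𝓛 A.
  normalDIdeal : (N : Subset) → IsNormal N → DIdeal
  ⟦ normalDIdeal N n ⟧ = N
  downClosed (normalDIdeal N n) x≤y y∈N =
    proj₂ n λ u u∈ → ≤-trans x≤y (u∈ _ y∈N)
  joinClosed (normalDIdeal N n) S S⊆ ((_ , least) , _) =
    proj₂ n λ u u∈ → least u λ s s∈S → u∈ s (S⊆ s∈S)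

  -- The D-ideal generated by P, as the intersection of the relative
  -- annihilators containing P.  This keeps it in the universe of A; `⊆cl` and
  -- `cl-least` show that it is the least D-ideal containing P.
  cl : Subset → DIdeal
  ⟦ cl P ⟧ x = ∀ a b → P ⊆ ⟦ ann a b ⟧ → x ∈ ⟦ ann a b ⟧
  downClosed (cl P) x≤y p a b q = downClosed (ann a b) x≤y (p a b q)
  joinClosed (cl P) S S⊆ d a b q = joinClosed (ann a b) S (λ s∈S → S⊆ s∈S a b q) d

  ⊆cl : (P : Subset) → P ⊆ ⟦ cl P ⟧
  ⊆cl P x∈P a b q = q x∈P

  cl-least : (P : Subset) (J : DIdeal) → P ⊆ ⟦ J ⟧ → ⟦ cl P ⟧ ⊆ ⟦ J ⟧
  cl-least P J P⊆J {x} x∈cl = joinClosed J (x ∧[ P ]) S⊆J (isJoin , dist)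
    where
    S⊆J : x ∧[ P ] ⊆ ⟦ J ⟧
    S⊆J (s , s∈P , y≈) =
      downClosed J (≤-trans (≤-reflexive y≈) (x∧y≤y x s)) (P⊆J s∈P)

    isJoin : IsJoin (x ∧[ P ]) x
    isJoin =
      (λ { _ (s , _ , y≈) → ≤-trans (≤-reflexive y≈) (x∧y≤x x s) }) ,
      λ u u∈ → ≤-trans (∧-greatest ≤-refl ≤-refl)
                       (x∈cl x u λ {s} s∈P → u∈ _ (s , s∈P , ≈-refl))

    dist : ∀ a → IsJoin (a ∧[ x ∧[ P ] ]) (a ∧ x)
    dist a =
      (λ { _ (s , s∈ , y≈) → ≤-trans (≤-reflexive y≈)
             (∧-greatest (x∧y≤x a s) (≤-trans (x∧y≤y a s) (proj₁ isJoin s s∈))) }) ,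
      λ u u∈ → ≤-trans (∧-greatest ≤-refl (x∧y≤y a x))
        (x∈cl (a ∧ x) u λ {s} s∈P → ≤-trans
          (∧-greatest (≤-trans (x∧y≤x (a ∧ x) s) (x∧y≤x a x))
            (∧-greatest (≤-trans (x∧y≤x (a ∧ x) s) (x∧y≤y a x)) (x∧y≤y (a ∧ x) s)))
          (u∈ _ (x ∧ s , (s , s∈P , ≈-refl) , ≈-refl)))

  infixr 7 _⊓_
  infixr 6 _⊔_
  infix 4 _≼_ _≋_

  _≼_ _≋_ : DIdeal → DIdeal → Set ℓ
  I ≼ J = ⟦ I ⟧ ⊆ ⟦ J ⟧
  I ≋ J = ⟦ I ⟧ ≐ ⟦ J ⟧

  _⊓_ _⊔_ : DIdeal → DIdeal → DIdeal
  ⟦ I ⊓ J ⟧ = ⟦ I ⟧ ∩ ⟦ J ⟧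
  downClosed (I ⊓ J) x≤y (p , q) = downClosed I x≤y p , downClosed J x≤y q
  joinClosed (I ⊓ J) S S⊆ d =
    joinClosed I S (proj₁ ∘ S⊆) d , joinClosed J S (proj₂ ∘ S⊆) d
  I ⊔ J = cl (⟦ I ⟧ ∪ ⟦ J ⟧)

  ⋁ : {X : Set ℓ} → (X → DIdeal) → DIdeal
  ⋁ {X} F = cl (⋃ X (⟦_⟧ ∘ F))

  ⋁-upper : {X : Set ℓ} (F : X → DIdeal) → ∀ i → F i ≼ ⋁ F
  ⋁-upper F i x∈ = ⊆cl _ (i , x∈)

  ⋁-least : {X : Set ℓ} (F : X → DIdeal) (J : DIdeal) → (∀ i → F i ≼ J) → ⋁ F ≼ J
  ⋁-least F J F≼J = cl-least _ J λ { (i , x∈) → F≼J i x∈ }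

  ⊓-distribˡ-⋁ : {X : Set ℓ} (I : DIdeal) (F : X → DIdeal) →
                 I ⊓ ⋁ F ≼ ⋁ (λ i → I ⊓ F i)
  ⊓-distribˡ-⋁ I F {x} (x∈I , x∈⋁) a b q = ≤-trans
    (∧-greatest (∧-greatest (x∧y≤x a x) (x∧y≤y a x)) (x∧y≤y a x))
    (x∈⋁ (a ∧ x) b λ { {y} (i , y∈) → ≤-trans
      (∧-greatest (≤-trans (x∧y≤x (a ∧ x) y) (x∧y≤x a x))
        (∧-greatest (≤-trans (x∧y≤x (a ∧ x) y) (x∧y≤y a x)) (x∧y≤y (a ∧ x) y)))
      (q (i , downClosed I (x∧y≤x x y) x∈I , downClosed (F i) (x∧y≤y x y) y∈)) })

  𝓑𝓛 : BoundedLattice (suc ℓ) ℓ ℓ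
  𝓑𝓛 = record
    { Carrier = DIdeal ; _≈_ = _≋_ ; _≤_ = _≼_
    ; _∨_ = _⊔_ ; _∧_ = _⊓_ ; ⊤ = ↓ ⊤ ; ⊥ = ↓ ⊥
    ; isBoundedLattice = record
      { isLattice = record
        { isPartialOrder = record
          { isPreorder = record
            { isEquivalence = record
              { refl  = (λ p → p) , (λ p → p)
              ; sym   = λ (f , g) → g , f
              ; trans = λ (f , g) (h , k) → (λ p → h (f p)) , (λ p → g (k p)) }
            ; reflexive = proj₁
            ; trans = λ f g p → g (f p) }
          ; antisym = λ f g → f , g }
        ; supremum = λ I J →
            (λ x∈ → ⊆cl (⟦ I ⟧ ∪ ⟦ J ⟧) (inj₁ x∈)) ,
            (λ x∈ → ⊆cl (⟦ I ⟧ ∪ ⟦ J ⟧) (inj₂ x∈)) ,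
            λ K f g → cl-least (⟦ I ⟧ ∪ ⟦ J ⟧) K λ { (inj₁ p) → f p ; (inj₂ q) → g q }
        ; infimum = λ I J → proj₁ , proj₂ , λ K f g p → f p , g p }
      ; maximum = λ I {x} _ → maximum x
      ; minimum = λ I {x} x≤⊥ → downClosed I x≤⊥
          (joinClosed I (λ _ → Lift⊥) (λ ())
            ( ((λ _ ()) , (λ u _ → minimum u))
            , λ a → (λ { _ (_ , () , _) }) , λ u _ → ≤-trans (x∧y≤y a ⊥) (minimum u))) } }
    where
    open import Data.Empty.Polymorphic using () renaming (⊥ to Lift⊥)

  𝓓𝓜 : Pred DIdeal ℓ
  𝓓𝓜 I = IsNormal ⟦ I ⟧

  𝓡 : Pred DIdeal ℓ
  𝓡 I = ∃₂ λ a b → I ≋ ann a b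

  data p𝓗 : Pred DIdeal (suc ℓ) where
    gen  : ∀ {I} → I ∈ 𝓡 → I ∈ p𝓗
    top  : ↓ ⊤ ∈ p𝓗
    bot  : ↓ ⊥ ∈ p𝓗
    meet : ∀ {I J} → I ∈ p𝓗 → J ∈ p𝓗 → I ⊓ J ∈ p𝓗
    join : ∀ {I J} → I ∈ p𝓗 → J ∈ p𝓗 → I ⊔ J ∈ p𝓗
    resp : ∀ {I J} → I ≋ J → I ∈ p𝓗 → J ∈ p𝓗

  -- Finite joins and the bounds need no constructors: κ is infinite, and the
  -- bounds ↓ ⊤ and ↓ ⊥ are principal.
  data 𝓑𝓛[_] (κ : RegularCardinal ℓ) : Pred DIdeal (suc ℓ) where
    gen  : ∀ a → ↓ a ∈ 𝓑𝓛[ κ ]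
    meet : ∀ {I J} → I ∈ 𝓑𝓛[ κ ] → J ∈ 𝓑𝓛[ κ ] → I ⊓ J ∈ 𝓑𝓛[ κ ]
    join : {X : Set ℓ} (F : X → DIdeal) → X ≺ RegularCardinal.∣_∣ κ →
           (∀ i → F i ∈ 𝓑𝓛[ κ ]) → ⋁ F ∈ 𝓑𝓛[ κ ]
    resp : ∀ {I J} → I ≋ J → I ∈ 𝓑𝓛[ κ ] → J ∈ 𝓑𝓛[ κ ]

_𝐇 : RegularCardinal ℓ → Pred (BoundedDistributiveLattice ℓ) (suc ℓ)
(κ 𝐇) A = 𝓡 ⊆ 𝓑𝓛[ κ ]
  where open Completions A

𝐩𝐫𝐨_𝐇 : RegularCardinal ℓ → Pred (BoundedDistributiveLattice ℓ) (suc ℓ)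
(𝐩𝐫𝐨 κ 𝐇) A = 𝓡 ⊆ 𝓑𝓛[ κ ] ∩ 𝓓𝓜
  where open Completions A

-- (1) holds because 𝓑𝓛[ κ ] is a bounded sublattice of 𝓑𝓛 A: κ is infinite, so
-- binary joins are joins of fewer than κ elements.  For (2), every D-ideal is an
-- intersection of relative annihilators; intersections of normal sets are
-- normal, so 𝓡 ⊆ 𝓓𝓜 already forces every D-ideal to be normal.
module Submission where

open import Defs
open import Data.Fin.Base using (Fin; toℕ)
open import Data.Fin.Patterns using (0F; 1F)
open import Data.Fin.Properties using (toℕ-injective; ℕ→Fin-notInjective)
open import Data.Nat.Base using (ℕ)
open import Data.Product.Base using (_×_; _,_; proj₁; proj₂)
open import Data.Sum.Base using (inj₁; inj₂)
open import Function.Base using (_∘_; id)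
open import Function.Bundles using (_⇔_; mk⇔; mk↣; Injection)
open import Level using (Level; Lift; lift; lower)
open import Relation.Binary.PropositionalEquality using (cong)
open import Relation.Unary using (_∈_; _⊆_; _∩_)

private
  variable
    ℓ : Level

-- Composed with `infinite`, an injection of κ into `Fin n` would embed ℕ in a finite set. This
-- makes finite families admissible index sets for `join`.
Fin≺ : (κ : RegularCardinal ℓ) (n : ℕ) → Lift ℓ (Fin n) ≺ RegularCardinal.∣_∣ κ
Fin≺ κ n =
    mk↣ {to = ℕ→κ.to ∘ toℕ ∘ lower}
      (λ eq → cong lift (toℕ-injective (ℕ→κ.injective eq)))
  , λ κ↣Fin → let module κ→Fin = Injection κ↣Fin in
      ℕ→Fin-notInjective (lower ∘ κ→Fin.to ∘ ℕ→κ.to)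
        (λ eq → ℕ→κ.injective (κ→Fin.injective (cong lift eq)))
  where
  module ℕ→κ = Injection (RegularCardinal.infinite κ)

module _ (A : BoundedDistributiveLattice ℓ) where
  open Completions A renaming (lower to lowerBounds)

  𝓑𝓛[]-⊔ : ∀ κ {I J} → I ∈ 𝓑𝓛[ κ ] → J ∈ 𝓑𝓛[ κ ] → I ⊔ J ∈ 𝓑𝓛[ κ ]
  -- `I ⊔ J` and `⋁ F` are closures of differently presented unions, so `resp` carries membership
  -- across.
  𝓑𝓛[]-⊔ κ {I} {J} I∈ J∈ = resp (⋁F≼I⊔J , I⊔J≼⋁F) (join F (Fin≺ κ 2) F∈)
    where
    F : Lift ℓ (Fin 2) → DIdeal
    F (lift 0F) = I
    F (lift 1F) = J

    F∈ : ∀ i → F i ∈ 𝓑𝓛[ κ ]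
    F∈ (lift 0F) = I∈
    F∈ (lift 1F) = J∈

    ⋁F≼I⊔J : ⋁ F ≼ I ⊔ J
    ⋁F≼I⊔J = ⋁-least F (I ⊔ J) λ
      { (lift 0F) → ⊆cl _ ∘ inj₁
      ; (lift 1F) → ⊆cl _ ∘ inj₂ }

    I⊔J≼⋁F : I ⊔ J ≼ ⋁ F
    I⊔J≼⋁F = cl-least _ (⋁ F) λ
      { (inj₁ x∈I) → ⋁-upper F (lift 0F) x∈I
      ; (inj₂ x∈J) → ⋁-upper F (lift 1F) x∈J }

  𝓡⊆𝓑𝓛[]⇒p𝓗⊆𝓑𝓛[] : ∀ κ → 𝓡 ⊆ 𝓑𝓛[ κ ] → p𝓗 ⊆ 𝓑𝓛[ κ ]
  𝓡⊆𝓑𝓛[]⇒p𝓗⊆𝓑𝓛[] κ 𝓡⊆ = go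
    where
    go : p𝓗 ⊆ 𝓑𝓛[ κ ]
    go (gen I∈𝓡)    = 𝓡⊆ I∈𝓡
    go top          = gen _
    go bot          = gen _
    go (meet I∈ J∈) = meet (go I∈) (go J∈)
    go (join I∈ J∈) = 𝓑𝓛[]-⊔ κ (go I∈) (go J∈)
    go (resp I≋J I∈) = resp I≋J (go I∈)

  𝓡⊆𝓓𝓜⇒normal : 𝓡 ⊆ 𝓓𝓜 → ∀ I → I ∈ 𝓓𝓜
  𝓡⊆𝓓𝓜⇒normal 𝓡⊆𝓓𝓜 I =
      (λ x∈I u u∈ → u∈ _ x∈I)
    -- As `I` is its own closure, it suffices to put x in every `ann a b` that contains `I`.
    , λ x∈ → cl-least ⟦ I ⟧ I id λ a b I⊆ann →
        -- An upper bound u of `ann a b` also bounds the smaller set `I`, hence x ≤ u; normality of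
        -- `ann a b` then gives x ∈ `ann a b`.
        proj₂ (𝓡⊆𝓓𝓜 {ann a b} (a , b , id , id)) λ u u∈ → x∈ u λ y y∈I → u∈ y (I⊆ann y∈I)

theorem4p23 : ∀ {ℓ : Level} (A : BoundedDistributiveLattice ℓ) (κ : RegularCardinal ℓ) →
    let open Completions A in
    (A ∈ (κ 𝐇) ⇔ p𝓗 ⊆ 𝓑𝓛[ κ ]) × (A ∈ (𝐩𝐫𝐨 κ 𝐇) ⇔ p𝓗 ⊆ 𝓑𝓛[ κ ] ∩ 𝓓𝓜)
theorem4p23 A κ =
    mk⇔ {A = A ∈ (κ 𝐇)} {B = p𝓗 ⊆ 𝓑𝓛[ κ ]}
      (λ 𝓡⊆ {I} → 𝓡⊆𝓑𝓛[]⇒p𝓗⊆𝓑𝓛[] A κ 𝓡⊆ {I})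
      (λ p𝓗⊆ I∈𝓡 → p𝓗⊆ (gen I∈𝓡))
  , mk⇔ {A = A ∈ (𝐩𝐫𝐨 κ 𝐇)} {B = p𝓗 ⊆ 𝓑𝓛[ κ ] ∩ 𝓓𝓜}
      (λ 𝓡⊆ {I} I∈ →
          𝓡⊆𝓑𝓛[]⇒p𝓗⊆𝓑𝓛[] A κ (λ {J} J∈𝓡 → proj₁ (𝓡⊆ {J} J∈𝓡)) I∈
        , 𝓡⊆𝓓𝓜⇒normal A (λ {J} J∈𝓡 → proj₂ (𝓡⊆ {J} J∈𝓡)) I)
      (λ p𝓗⊆ I∈𝓡 → p𝓗⊆ (gen I∈𝓡))
  where
  open Completions A
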